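{- The update algorithm of AGP-Dynamic processes each graph update (an edge insertion or an edge deletion) in $O(1)$ amortized time.
   Context: $G=\langle V,E\rangle$ is an undirected unweighted graph with neighborhoods $N[u]=\{v\in V:(u,v)\in E\}$ and degrees $d_u=|N[u]|$, modified by a sequence of edge insertions and deletions. For each vertex $u$, AGP-Dynamic maintains a reference degree $\tilde d_u$, initially $\tilde d_u=d_u$, and a sorted linked list $B[u]$ of non-empty power-of-two buckets holding the neighbors of $u$: a neighbor $v\in N[u]$ is stored in the bucket of index $j$ of $B[u]$ with $2^j\le\tilde d_v<2^{j+1}$. In the Word RAM model this list is implemented in $O(|B[u]|)$ space so that a bucket can be inserted into or deleted from $B[u]$ in $O(1)$ time, and hence inserting or removing a neighbor in $B[u]$ takes $O(1)$ time. Update algorithm for an edge update $(u,w)$: if it is a deletion, remove $u$ from $B[w]$ and set $d_u\leftarrow d_u-1$; otherwise insert $u$ into $B[w]$ and set $d_u\leftarrow d_u+1$. Then, if $d_u<\frac12\tilde d_u$ or $d_u>2\tilde d_u$: for each $v\in N[u]$ update the position of $u$ in $B[v]$ according to the current value of $d_u$, and set $\tilde d_u\leftarrow d_u$. Handle $w$ symmetrically (with the roles of $u$ and $w$ exchanged). -}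

module Defs where

open import Data.Bool.Base using (if_then_else_)
open import Data.Fin.Base using (Fin)
open import Data.Fin.Subset
  using (Subset; _∈_; _∉_; Nonempty; ∣_∣; ⁅_⁆; _∪_; _-_)
open import Data.Fin.Subset.Properties using (_∈?_)
open import Data.List.Base using (List; []; _∷_; allFin; filter)
open import Data.List.Relation.Unary.Any using (Any)
open import Data.List.Relation.Unary.Linked using (Linked)
open import Data.Nat.Base using (ℕ; suc; _+_; _∸_; _*_; _^_; _≤_; _<_; _⊔_)
open import Data.Nat.Properties using (_<?_)
open import Data.Product.Base using (_×_; ∃)
open import Data.Sum.Base using (_⊎_)
open import Data.Unit.Base using (⊤)
open import Data.Vec.Functional using (updateAt)
open import Function.Base using (_on_; const)
open import Function.Bundles using (_⇔_)
open import Relation.Binary.PropositionalEquality using (_≡_; _≢_)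
open import Relation.Nullary.Decidable using (⌊_⌋; _⊎-dec_)
open import Relation.Nullary.Negation using (¬_)

private
  variable
    n : ℕ
    A A′ : Set

Neighbourhoods : ℕ → Set
Neighbourhoods n = Fin n → Subset n

record Graph (n : ℕ) : Set where
  field
    N         : Neighbourhoods n
    symmetric : ∀ {u v} → v ∈ N u → u ∈ N v
    loopless  : ∀ {u} → u ∉ N u

data Update (n : ℕ) : Set where
  insertion deletion : (u w : Fin n) → Update n

edit : Update n → Neighbourhoods n → Neighbourhoods n
edit (insertion u w) N =
  updateAt (updateAt N u (_∪ ⁅ w ⁆)) w (_∪ ⁅ u ⁆)
edit (deletion  u w) N =
  updateAt (updateAt N u (_- w)) w (_- u)

Admissible : Neighbourhoods n → Update n → Set
Admissible N (insertion u w) = u ≢ w × w ∉ N u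
Admissible N (deletion  u w) = w ∈ N u

AllAdmissible : Neighbourhoods n → List (Update n) → Set
AllAdmissible N []       = ⊤
AllAdmissible N (e ∷ es) = Admissible N e × AllAdmissible (edit e N) es

record Timed (A : Set) : Set where
  constructor _after_
  field
    value : A
    time  : ℕ

open Timed public

return : A → Timed A
return a = a after 0

step : A → Timed A
step a = a after 1

infixl 1 _>>=_
_>>=_ : Timed A → (A → Timed A′) → Timed A′
(a after s) >>= f = value (f a) after (s + time (f a))

record Bucket (n : ℕ) : Set where
  field
    index    : ℕ
    members  : Subset n
    nonempty : Nonempty members

open Bucket public

-- A vertex of reference degree δ ≥ 1 belongs to bucket j exactly when
-- 2 ^ j ≤ δ < 2 ^ (j + 1).  No j qualifies for δ = 0, yet an isolated
-- vertex is inserted with reference degree 0 when it gains its first edge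
-- (and repositioned at once); δ = 0 is sent to bucket 0.
BucketIndex : ℕ → ℕ → Set
BucketIndex δ j = 2 ^ j ≤ 1 ⊔ δ × δ < 2 ^ suc j

_∈[_]_ : Fin n → ℕ → List (Bucket n) → Set
v ∈[ j ] bs = Any (λ b → index b ≡ j × v ∈ members b) bs

Stored : Fin n → List (Bucket n) → Set
Stored v bs = ∃ λ j → v ∈[ j ] bs

-- The Word RAM implementation of the lists B[u] is a parameter; `bound`
-- does not depend on n.  Insertion has to be correct and fast only for a
-- vertex that is not stored and a degree not exceeding the number of
-- vertices (bucket indices then fit in a machine word), removal only for a
-- vertex that is stored.
record BucketLists : Set₁ where
  field
    Rep    : ℕ → Set
    view   : Rep n → List (Bucket n)
    sorted : (L : Rep n) → Linked (_<_ on index) (view L)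

    insert : (v : Fin n) (δ : ℕ) → Rep n → Timed (Rep n)
    remove : (v : Fin n) → Rep n → Timed (Rep n)
    bound  : ℕ

    insert-view : ∀ {v : Fin n} {δ} (L : Rep n) →
                  ¬ Stored v (view L) → δ ≤ n →
                  ∀ x j → x ∈[ j ] view (value (insert v δ L)) ⇔
                          ((x ≡ v × BucketIndex δ j) ⊎ x ∈[ j ] view L)
    insert-time : ∀ {v : Fin n} {δ} (L : Rep n) →
                  ¬ Stored v (view L) → δ ≤ n →
                  time (insert v δ L) ≤ bound

    remove-view : ∀ {v : Fin n} (L : Rep n) → Stored v (view L) →
                  ∀ x j → x ∈[ j ] view (value (remove v L)) ⇔
                          (x ≢ v × x ∈[ j ] view L)
    remove-time : ∀ {v : Fin n} (L : Rep n) → Stored v (view L) →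
                  time (remove v L) ≤ bound

module AGP-Dynamic (lists : BucketLists) where
  open BucketLists lists

  record State (n : ℕ) : Set where
    field
      N : Neighbourhoods n
      d : Fin n → ℕ
      d̃ : Fin n → ℕ
      B : Fin n → Rep n

  open State public

  record Initial (G : Graph n) (s : State n) : Set where
    field
      N-initial : ∀ u → N s u ≡ Graph.N G u
      d-initial : ∀ u → d s u ≡ ∣ Graph.N G u ∣
      d̃-initial : ∀ u → d̃ s u ≡ d s u
      B-initial : ∀ u v j → v ∈[ j ] view (B s u) ⇔
                            (v ∈ Graph.N G u × BucketIndex (d̃ s v) j)

  Command : ℕ → Set
  Command n = State n → Timed (State n)

  -- Adjacency list of u: its traversal is charged one step per element, on
  -- top of the loop body, and one step for reaching the end.
  neighbours : State n → Fin n → List (Fin n)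
  neighbours s u = filter (_∈? N s u) (allFin _)

  forEach : List (Fin n) → (Fin n → Command n) → Command n
  forEach []       body s = step s
  forEach (v ∷ vs) body s = do
    s ← step s
    s ← body v s
    forEach vs body s

  setB : Fin n → Rep n → Command n
  setB u L s = step record s { B = updateAt (B s) u (const L) }

  editGraph : Update n → Command n
  editGraph e s = step record s { N = edit e (N s) }

  insertInto removeFrom : (w u : Fin n) → Command n
  insertInto w u s = do
    L ← insert u (d̃ s u) (B s w)
    setB w L s
  removeFrom w u s = do
    L ← remove u (B s w)
    setB w L s

  increment decrement : Fin n → Command n
  increment u s = step record s { d = updateAt (d s) u (_+ 1) }
  decrement u s = step record s { d = updateAt (d s) u (_∸ 1) }

  reposition : (u v : Fin n) → Command n
  reposition u v s = do
    L  ← remove u (B s v)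
    L′ ← insert u (d s u) L
    setB v L′ s

  rebuild : Fin n → Command n
  rebuild u s = do
    s ← forEach (neighbours s u) (reposition u) s
    step record s { d̃ = updateAt (d̃ s) u (const (d s u)) }

  -- The first disjunct is d u < ½ · d̃ u with the denominator cleared.
  check : Fin n → Command n
  check u s = do
    s ← step s
    if ⌊ (2 * d s u <? d̃ s u) ⊎-dec (2 * d̃ s u <? d s u) ⌋
      then rebuild u s
      else return s

  handleInsertion handleDeletion : (u w : Fin n) → Command n
  handleInsertion u w s = do
    s ← insertInto w u s
    s ← increment u s
    check u s
  handleDeletion u w s = do
    s ← removeFrom w u s
    s ← decrement u s
    check u s

  process : Update n → Command n
  process e@(insertion u w) s = do
    s ← editGraph e s
    s ← handleInsertion u w s
    handleInsertion w u s
  process e@(deletion u w) s = do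
    s ← editGraph e s
    s ← handleDeletion u w s
    handleDeletion w u s

  processAll : List (Update n) → Command n
  processAll []       s = return s
  processAll (e ∷ es) s = do
    s ← process e s
    processAll es s

{-# OPTIONS --safe #-}

-- Potential method.  With b the cost bound of the bucket lists, a rebuild of u
-- repositions u in d u lists, at cost a = 2 b + 2 each; it is triggered only
-- when d u ≤ 2 ∣ d u - d̃ u ∣, and it makes d̃ u equal to d u.  The potential
-- Σᵤ 2 a ∣ d u - d̃ u ∣ therefore pays for all rebuilds; it vanishes initially,
-- and an edge update increases it by at most 4 a.

module Submission where

open import Defs
open import Data.Bool.Base using (true; false)
open import Data.Fin.Base using (Fin; zero; suc; punchIn)
open import Data.Fin.Properties using (punchInᵢ≢i)
import Data.Fin.Properties as Fin
open import Data.Fin.Subset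
  using (Subset; inside; outside; _∈_; _∉_; ∣_∣; ⁅_⁆; _∪_)
  renaming (_-_ to _∖_)
open import Data.Fin.Subset.Properties
  using (_∈?_; drop-there; ∣p∣≤n; ∪-identityʳ; p─⊥≡p; x∈p∪q⁺; x∈p∪q⁻; x∈⁅x⁆;
         x∈⁅y⁆⇒x≡y; x∈p∧x≢y⇒x∈p-y; p─q⊆p)
open import Data.List.Base using (List; []; _∷_; length; map; filter; allFin; tabulate)
open import Data.List.Properties using (filter-≐; map-tabulate)
open import Data.List.Relation.Unary.All using (All; []; _∷_)
open import Data.List.Relation.Unary.All.Properties using (all-filter)
open import Data.Nat.Base
  using (ℕ; zero; suc; _+_; _∸_; _*_; _^_; _≤_; _<_; z≤n; s≤s; ∣_-_∣)
open import Data.Nat.Properties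
open import Algebra.Properties.CommutativeMonoid.Sum +-0-commutativeMonoid
  using (sum; sum-remove; sum-cong-≗; sum-replicate-zero)
open import Data.Nat.Tactic.RingSolver using (solve-∀)
open import Data.Product.Base using (_×_; _,_; ∃; proj₁; proj₂; map₁; map₂; swap)
  renaming (map to map-×)
open import Data.Sum.Base using (_⊎_; inj₁; inj₂)
import Data.Sum.Base as Sum
open import Data.Vec.Base using ([]; _∷_; here; there)
open import Data.Vec.Functional using (updateAt)
open import Data.Vec.Functional.Properties using (updateAt-updates; updateAt-minimal)
open import Function.Base using (_∘_; id; const)
open import Function.Bundles using (_⇔_; mk⇔; Equivalence)
open import Level using (0ℓ)
open import Relation.Binary.PropositionalEquality
  using (_≡_; _≢_; _≗_; refl; sym; trans; cong; cong-app; subst; module ≡-Reasoning)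
open import Relation.Nullary.Decidable using (yes; no; does; _⊎-dec_)
open import Relation.Nullary.Negation using (¬_; contradiction)
open import Relation.Unary using (Pred; Decidable)

open Equivalence using (to; from)

private
  variable
    n : ℕ
    A A′ : Set

-- Functions, subsets and sums

updateAt-elim : (P : Fin n → A → Set) {f : A → A} {xs : Fin n → A} (i : Fin n) →
                P i (f (xs i)) → (∀ j → j ≢ i → P j (xs j)) →
                ∀ j → P j (updateAt xs i f j)
updateAt-elim P {xs = xs} i pᵢ pⱼ j with j Fin.≟ i
... | yes refl = subst (P i) (sym (updateAt-updates i xs)) pᵢ
... | no j≢i   = subst (P j) (sym (updateAt-minimal j i xs j≢i)) (pⱼ j j≢i)

updateAt⁺ : (R : A → A′ → Set) {f : A → A} {g : A′ → A′}
            {xs : Fin n → A} {ys : Fin n → A′} (i : Fin n) →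
            R (f (xs i)) (g (ys i)) → (∀ j → R (xs j) (ys j)) →
            ∀ j → R (updateAt xs i f j) (updateAt ys i g j)
updateAt⁺ R {ys = ys} i r rs = updateAt-elim (λ j x → R x (updateAt ys i _ j)) i
  (subst (R _) (sym (updateAt-updates i ys)) r)
  (λ j j≢i → subst (R _) (sym (updateAt-minimal j i ys j≢i)) (rs j))

-- Serves twice: for a neighbourhood that gains an element and for a bucket list that gains a
-- vertex. Both equivalences then have the same shape and can be composed. `updateAt-×` plays this
-- role for removals.
updateAt-⊎ : (Q : A → Set) {S : Set} {f : A → A} {xs : Fin n → A} (i : Fin n) →
             Q (f (xs i)) ⇔ (S ⊎ Q (xs i)) →
             ∀ j → Q (updateAt xs i f j) ⇔ ((j ≡ i × S) ⊎ Q (xs j))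
updateAt-⊎ Q {S} {xs = xs} i q =
  updateAt-elim (λ j x → Q x ⇔ ((j ≡ i × S) ⊎ Q (xs j))) i
    (mk⇔ (Sum.map₁ (refl ,_) ∘ to q) (from q ∘ Sum.map₁ proj₂))
    (λ j j≢i → mk⇔ inj₂ Sum.[ (λ (j≡i , _) → contradiction j≡i j≢i) , id ])

updateAt-× : (Q : A → Set) {S : Set} {f : A → A} {xs : Fin n → A} (i : Fin n) →
             Q (f (xs i)) ⇔ (¬ S × Q (xs i)) →
             ∀ j → Q (updateAt xs i f j) ⇔ (¬ (j ≡ i × S) × Q (xs j))
updateAt-× Q {S} {xs = xs} i q =
  updateAt-elim (λ j x → Q x ⇔ (¬ (j ≡ i × S) × Q (xs j))) i
    (mk⇔ (map₁ (_∘ proj₂) ∘ to q) (from q ∘ map₁ (_∘ (refl ,_))))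
    (λ j j≢i → mk⇔ ((j≢i ∘ proj₁) ,_) proj₂)

∣p∪⁅x⁆∣≡∣p∣+1 : {p : Subset n} {x : Fin n} → x ∉ p → ∣ p ∪ ⁅ x ⁆ ∣ ≡ ∣ p ∣ + 1
∣p∪⁅x⁆∣≡∣p∣+1 {p = inside  ∷ p} {zero}  x∉p = contradiction here x∉p
∣p∪⁅x⁆∣≡∣p∣+1 {p = outside ∷ p} {zero}  x∉p =
  trans (cong (suc ∘ ∣_∣) (∪-identityʳ p)) (+-comm 1 _)
∣p∪⁅x⁆∣≡∣p∣+1 {p = inside  ∷ p} {suc x} x∉p = cong suc (∣p∪⁅x⁆∣≡∣p∣+1 (x∉p ∘ there))
∣p∪⁅x⁆∣≡∣p∣+1 {p = outside ∷ p} {suc x} x∉p = ∣p∪⁅x⁆∣≡∣p∣+1 (x∉p ∘ there)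

∣p∖x∣+1≡∣p∣ : {p : Subset n} {x : Fin n} → x ∈ p → ∣ p ∖ x ∣ + 1 ≡ ∣ p ∣
∣p∖x∣+1≡∣p∣ {p = inside  ∷ p} here =
  trans (+-comm _ 1) (cong (suc ∘ ∣_∣) (p─⊥≡p p))
∣p∖x∣+1≡∣p∣ {p = inside  ∷ p} (there x∈p) = cong suc (∣p∖x∣+1≡∣p∣ x∈p)
∣p∖x∣+1≡∣p∣ {p = outside ∷ p} (there x∈p) = ∣p∖x∣+1≡∣p∣ x∈p

x∉p∖x : {p : Subset n} {x : Fin n} → x ∉ p ∖ x
x∉p∖x {p = _ ∷ p} {zero}  ()
x∉p∖x {p = _ ∷ p} {suc x} (there x∈) = x∉p∖x x∈

length-filter-map : {P : Pred A′ 0ℓ} (P? : Decidable P) (f : A → A′) (xs : List A) →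
                    length (filter P? (map f xs)) ≡ length (filter (P? ∘ f) xs)
length-filter-map P? f []       = refl
length-filter-map P? f (x ∷ xs) with does (P? (f x))
... | true  = cong suc (length-filter-map P? f xs)
... | false = length-filter-map P? f xs

-- Turns the number of iterations of a loop over `neighbours` into a degree.
length-filter-∈? : (p : Subset n) → length (filter (_∈? p) (allFin n)) ≡ ∣ p ∣
length-filter-∈? {n = zero}  []      = refl
length-filter-∈? {n = suc n} (s ∷ p) = count s
  where
  tail-count : ∀ s → length (filter (_∈? (s ∷ p)) (tabulate suc)) ≡ ∣ p ∣
  tail-count s = begin
    length (filter (_∈? (s ∷ p)) (tabulate suc))
      ≡⟨ cong (length ∘ filter (_∈? (s ∷ p))) (map-tabulate {n = n} id suc) ⟨
    length (filter (_∈? (s ∷ p)) (map suc (allFin n)))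
      ≡⟨ length-filter-map (_∈? (s ∷ p)) suc (allFin n) ⟩
    length (filter ((_∈? (s ∷ p)) ∘ suc) (allFin n))
      ≡⟨ cong length (filter-≐ _ _ (drop-there , there) (allFin n)) ⟩
    length (filter (_∈? p) (allFin n))
      ≡⟨ length-filter-∈? p ⟩
    ∣ p ∣  ∎
    where open ≡-Reasoning
  count : ∀ s → length (filter (_∈? (s ∷ p)) (allFin (suc n))) ≡ ∣ s ∷ p ∣
  count inside  = cong suc (tail-count inside)
  count outside = tail-count outside

-- Only the summand at `i` changes, so an amortised inequality needs checking there alone. `k`
-- stands for the time spent and `l` for the amortised allowance.
sum-mono-at : ∀ {k l} {f g : Fin n → ℕ} (i : Fin n) → (∀ j → j ≢ i → f j ≡ g j) →
              k + f i ≤ l + g i → k + sum f ≤ l + sum g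
sum-mono-at {n = suc n} {k} {l} {f} {g} i f≡g k+fᵢ≤l+gᵢ = begin
  k + sum f                                ≡⟨ cong (k +_) (sum-remove {i = i} f) ⟩
  k + (f i + sum (f ∘ punchIn i))          ≡⟨ +-assoc k (f i) _ ⟨
  k + f i + sum (f ∘ punchIn i)            ≤⟨ +-monoˡ-≤ _ k+fᵢ≤l+gᵢ ⟩
  l + g i + sum (f ∘ punchIn i)            ≡⟨ cong (l + g i +_) (sum-cong-≗ (λ j → f≡g (punchIn i j) (punchInᵢ≢i i j))) ⟩
  l + g i + sum (g ∘ punchIn i)            ≡⟨ +-assoc l (g i) _ ⟩
  l + (g i + sum (g ∘ punchIn i))          ≡⟨ cong (l +_) (sum-remove {i = i} g) ⟨
  l + sum g                                ∎
  where open ≤-Reasoning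

-- Rebuild threshold and bucket indices

-- If `e` is more than twice `d`, the gap exceeds `d` itself; if `e` is less than half of `d`, it
-- exceeds half of `d`. The second case is the one that needs the factor 2.
far⇒≤2*∣-∣ : ∀ d e → 2 * d < e ⊎ 2 * e < d → d ≤ 2 * ∣ d - e ∣
far⇒≤2*∣-∣ d e (inj₁ 2d<e) = ≤-trans (+-cancelˡ-≤ d _ _ (begin
  d + d            ≡⟨ cong (d +_) (+-identityʳ d) ⟨
  2 * d            ≤⟨ <⇒≤ 2d<e ⟩
  e                ≤⟨ m≤n+∣n-m∣ e d ⟩
  d + ∣ d - e ∣    ∎)) (m≤m+n _ _)
  where open ≤-Reasoning
far⇒≤2*∣-∣ d e (inj₂ 2e<d) = +-cancelˡ-≤ d _ _ (begin
  d + d                    ≡⟨ cong (d +_) (+-identityʳ d) ⟨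
  2 * d                    ≤⟨ *-monoʳ-≤ 2 (m≤n+∣m-n∣ d e) ⟩
  2 * (e + ∣ d - e ∣)      ≡⟨ *-distribˡ-+ 2 e _ ⟩
  2 * e + 2 * ∣ d - e ∣    ≤⟨ +-monoˡ-≤ _ (<⇒≤ 2e<d) ⟩
  d + 2 * ∣ d - e ∣        ∎)
  where open ≤-Reasoning

-- Induction on `δ`: the index stays the same until `δ` reaches the next power of two, and then
-- grows by one.
bucketIndex : ∀ δ → ∃ (BucketIndex δ)
bucketIndex zero    = 0 , s≤s z≤n , s≤s z≤n
bucketIndex (suc δ) with bucketIndex δ
... | j , 2^j≤δ , δ<2^[1+j] with suc δ <? 2 ^ suc j
...   | yes 1+δ<2^[1+j] = j , ≤-trans 2^j≤δ (⊔-monoʳ-≤ 1 (n≤1+n δ)) , 1+δ<2^[1+j]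
...   | no  1+δ≮2^[1+j] =
  suc j , ≮⇒≥ 1+δ≮2^[1+j] , ≤-<-trans δ<2^[1+j] (^-monoʳ-< 2 (s≤s (s≤s z≤n)) (n<1+n (suc j)))

-- Edits of neighbourhoods

insertEdge-∈ : ∀ {M : Neighbourhoods n} {u w v} x →
               v ∈ updateAt M u (_∪ ⁅ w ⁆) x ⇔ ((x ≡ u × v ≡ w) ⊎ v ∈ M x)
insertEdge-∈ {M = M} {u} {w} {v} = updateAt-⊎ (v ∈_) u
  (mk⇔ (Sum.swap ∘ Sum.map₂ (x∈⁅y⁆⇒x≡y w) ∘ x∈p∪q⁻ (M u) ⁅ w ⁆)
       (x∈p∪q⁺ ∘ Sum.swap ∘ Sum.map₁ λ { refl → x∈⁅x⁆ w }))

deleteEdge-∈ : ∀ {M : Neighbourhoods n} {u w v} x →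
               v ∈ updateAt M u (_∖ w) x ⇔ (¬ (x ≡ u × v ≡ w) × v ∈ M x)
deleteEdge-∈ {M = M} {u} {w} {v} = updateAt-× (v ∈_) u
  (mk⇔ (λ v∈ → (λ { refl → x∉p∖x v∈ }) , p─q⊆p (M u) ⁅ w ⁆ v∈)
       (λ (v≢w , v∈) → x∈p∧x≢y⇒x∈p-y v∈ v≢w))

-- Neighbourhoods are functions and `Initial` fixes them only pointwise, so edits have to respect
-- `≗`.
edit-cong : ∀ (e : Update n) {M M′} → M ≗ M′ → edit e M ≗ edit e M′
edit-cong (insertion u w) M≗M′ =
  updateAt⁺ _≡_ w (cong (_∪ ⁅ u ⁆) (M₁ w)) M₁
  where M₁ = updateAt⁺ _≡_ u (cong (_∪ ⁅ w ⁆) (M≗M′ u)) M≗M′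
edit-cong (deletion u w) M≗M′ =
  updateAt⁺ _≡_ w (cong (_∖ u) (M₁ w)) M₁
  where M₁ = updateAt⁺ _≡_ u (cong (_∖ w) (M≗M′ u)) M≗M′

-- Symmetry survives because `EdgeAfter` treats both orientations of the edge alike. On insertion,
-- `u ≢ w` rules out a new loop.
edited : (G : Graph n) (e : Update n) → Admissible (Graph.N G) e → Graph n
edited G e@(insertion u w) (u≢w , _) = record
  { N         = edit e N
  ; symmetric = λ {x} {y} → from (edit-∈ x y) ∘ flipped ∘ to (edit-∈ y x)
  ; loopless  = λ {x} → loop ∘ to (edit-∈ x x)
  }
  where
  open Graph G
  EdgeAfter : _ → _ → Set
  EdgeAfter y x = (x ≡ w × y ≡ u) ⊎ (x ≡ u × y ≡ w) ⊎ y ∈ N x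
  edit-∈ : ∀ y x → y ∈ edit e N x ⇔ EdgeAfter y x
  edit-∈ y x = mk⇔ (Sum.map₂ (to (insertEdge-∈ x)) ∘ to (insertEdge-∈ x))
                   (from (insertEdge-∈ x) ∘ Sum.map₂ (from (insertEdge-∈ x)))
  flipped : ∀ {x y} → EdgeAfter y x → EdgeAfter x y
  flipped (inj₁ (x≡w , y≡u))        = inj₂ (inj₁ (y≡u , x≡w))
  flipped (inj₂ (inj₁ (x≡u , y≡w))) = inj₁ (y≡w , x≡u)
  flipped (inj₂ (inj₂ y∈Nx))        = inj₂ (inj₂ (symmetric y∈Nx))
  loop : ∀ {x} → ¬ EdgeAfter x x
  loop (inj₁ (x≡w , x≡u))        = u≢w (trans (sym x≡u) x≡w)
  loop (inj₂ (inj₁ (x≡u , x≡w))) = u≢w (trans (sym x≡u) x≡w)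
  loop (inj₂ (inj₂ x∈Nx))        = loopless x∈Nx
edited G e@(deletion u w) _ = record
  { N         = edit e N
  ; symmetric = λ {x} {y} → from (edit-∈ x y) ∘ flipped ∘ to (edit-∈ y x)
  ; loopless  = λ {x} → loopless ∘ proj₂ ∘ proj₂ ∘ to (edit-∈ x x)
  }
  where
  open Graph G
  EdgeAfter : _ → _ → Set
  EdgeAfter y x = ¬ (x ≡ w × y ≡ u) × ¬ (x ≡ u × y ≡ w) × y ∈ N x
  edit-∈ : ∀ y x → y ∈ edit e N x ⇔ EdgeAfter y x
  edit-∈ y x = mk⇔ (map₂ (to (deleteEdge-∈ x)) ∘ to (deleteEdge-∈ x))
                   (from (deleteEdge-∈ x) ∘ map₂ (from (deleteEdge-∈ x)))
  flipped : ∀ {x y} → EdgeAfter y x → EdgeAfter x y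
  flipped (¬wu , ¬uw , y∈Nx) =
    (λ (y≡w , x≡u) → ¬uw (x≡u , y≡w)) , (λ (y≡u , x≡w) → ¬wu (x≡w , y≡u)) , symmetric y∈Nx

-- Amortised analysis

module _ (lists : BucketLists) where
  open BucketLists lists
  open AGP-Dynamic lists

  -- Stored vertices, regardless of their bucket

  -- The preconditions of the list operations mention only whether a vertex is stored, so the cost
  -- analysis can forget the bucket indices.
  insert-stored : ∀ {x v : Fin n} {δ} (L : Rep n) → ¬ Stored v (view L) → δ ≤ n →
                  Stored x (view (value (insert v δ L))) ⇔ (x ≡ v ⊎ Stored x (view L))
  insert-stored {x = x} {v} {δ} L v∉L δ≤n = mk⇔
    (λ (j , x∈) → Sum.map proj₁ (j ,_) (to (view⇔ x j) x∈))
    -- The inserted vertex does end up in some bucket, since every degree has an index.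
    Sum.[ (λ x≡v → let j , δ∈j = bucketIndex δ in j , from (view⇔ x j) (inj₁ (x≡v , δ∈j)))
        , (λ (j , x∈) → j , from (view⇔ x j) (inj₂ x∈)) ]
    where view⇔ = insert-view L v∉L δ≤n

  remove-stored : ∀ {x v : Fin n} (L : Rep n) → Stored v (view L) →
                  Stored x (view (value (remove v L))) ⇔ (x ≢ v × Stored x (view L))
  remove-stored {x = x} L v∈L = mk⇔
    (λ (j , x∈) → map₂ (j ,_) (to (view⇔ x j) x∈))
    (λ (x≢v , j , x∈) → j , from (view⇔ x j) (x≢v , x∈))
    where view⇔ = remove-view L v∈L

  -- Potential and amortised cost

  -- In order: the traversal step of the loop, the removal, the insertion, and writing the list
  -- back.
  repositionCost : ℕ
  repositionCost = suc (bound + (bound + 1))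

  gap : State n → Fin n → ℕ
  gap s u = 2 * repositionCost * ∣ d s u - d̃ s u ∣

  potential : State n → ℕ
  potential s = sum (gap s)

  -- The usual bound on time plus change of potential, arranged so that no subtraction of natural
  -- numbers occurs.
  Amortised : ℕ → State n → Timed (State n) → Set
  Amortised k s t = time t + potential (value t) ≤ k + potential s

  -- The potential of the intermediate state cancels, so amortised costs add up.
  >>=-amortised : ∀ {k l} (s : State n) t (f : Command n) →
                  Amortised k s t → Amortised l (value t) (f (value t)) →
                  Amortised (k + l) s (t >>= f)
  >>=-amortised {k = k} {l} s t f t≤k f≤l = begin
    time t + time t′ + potential (value t′)      ≡⟨ +-assoc (time t) _ _ ⟩
    time t + (time t′ + potential (value t′))    ≤⟨ +-monoʳ-≤ (time t) f≤l ⟩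
    time t + (l + potential (value t))           ≡⟨ swap₁ (time t) l _ ⟩
    l + (time t + potential (value t))           ≤⟨ +-monoʳ-≤ l t≤k ⟩
    l + (k + potential s)                        ≡⟨ swap₂ l k _ ⟩
    k + l + potential s                          ∎
    where
    open ≤-Reasoning
    t′ = f (value t)
    swap₁ : ∀ a b c → a + (b + c) ≡ b + (a + c)
    swap₁ = solve-∀
    swap₂ : ∀ a b c → a + (b + c) ≡ b + a + c
    swap₂ = solve-∀

  -- M u is the set of all v whose list B v stores u.  It coincides with N u
  -- between updates; handling one end point of an edge changes M only there.
  record Consistent (M : Neighbourhoods n) (s : State n) : Set where
    field
      stored      : ∀ x v → Stored x (view (B s v)) ⇔ v ∈ M x
      degree      : ∀ x → d s x ≡ ∣ M x ∣
      reference≤n : ∀ x → d̃ s x ≤ n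

    degree≤n : ∀ x → d s x ≤ n
    degree≤n x = subst (_≤ n) (sym (degree x)) (∣p∣≤n (M x))

  open Consistent

  -- `N` is edited once, before either endpoint is handled; `sameGraph` lets the second endpoint
  -- still find its edited neighbourhood.
  record Handled (k : ℕ) (M : Neighbourhoods n) (s : State n) (t : Timed (State n)) : Set where
    field
      consistent : Consistent M (value t)
      sameGraph  : N (value t) ≡ N s
      amortised  : Amortised k s t

  open Handled

  -- Rebuilding a vertex

  -- The same vertex is taken out and put back, so only its bucket can change. `v ∈ M u` justifies
  -- the removal, and the removal justifies the insertion. The `suc` is the traversal step.
  reposition-consistent : ∀ {M : Neighbourhoods n} {s} {u v} → Consistent M s → v ∈ M u →
                          Consistent M (value (reposition u v s)) ×
                          suc (time (reposition u v s)) ≤ repositionCost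
  reposition-consistent {M = M} {s} {u} {v} c v∈Mu = record
    { stored      = λ x → updateAt-elim (λ v′ L → Stored x (view L) ⇔ v′ ∈ M x) v
                            (mk⇔ (old x ∘ to (insert⇔ x)) (from (insert⇔ x) ∘ new x))
                            (λ v′ _ → stored c x v′)
    ; degree      = degree c
    ; reference≤n = reference≤n c
    } , s≤s (+-mono-≤ (remove-time (B s v) u∈B)
              (+-monoˡ-≤ 1 (insert-time (value removed) u∉B′ (degree≤n c u))))
    where
    removed = remove u (B s v)
    u∈B : Stored u (view (B s v))
    u∈B = from (stored c u v) v∈Mu
    remove⇔ : ∀ x → Stored x (view (value removed)) ⇔ (x ≢ u × Stored x (view (B s v)))
    remove⇔ x = remove-stored (B s v) u∈B
    u∉B′ : ¬ Stored u (view (value removed))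
    u∉B′ u∈B′ = proj₁ (to (remove⇔ u) u∈B′) refl
    insert⇔ : ∀ x → Stored x (view (value (insert u (d s u) (value removed)))) ⇔
                    (x ≡ u ⊎ Stored x (view (value removed)))
    insert⇔ x = insert-stored (value removed) u∉B′ (degree≤n c u)
    old : ∀ x → x ≡ u ⊎ Stored x (view (value removed)) → v ∈ M x
    old x (inj₁ refl) = v∈Mu
    old x (inj₂ x∈)   = to (stored c x v) (proj₂ (to (remove⇔ x) x∈))
    new : ∀ x → v ∈ M x → x ≡ u ⊎ Stored x (view (value removed))
    new x v∈Mx with x Fin.≟ u
    ... | yes x≡u = inj₁ x≡u
    ... | no  x≢u = inj₂ (from (remove⇔ x) (x≢u , from (stored c x v) v∈Mx))

  -- The equation says that the loop touches nothing but `B`, so the degrees afterwards are those of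
  -- `s`. The summand 1 is the step for reaching the end of the list.
  repositionAll : ∀ {M : Neighbourhoods n} {s u} vs → All (_∈ M u) vs → Consistent M s →
                  let t = forEach vs (reposition u) s in
                  Consistent M (value t) ×
                  value t ≡ record s { B = B (value t) } ×
                  time t ≤ 1 + length vs * repositionCost
  repositionAll []       []            c = record { Consistent c } , refl , ≤-refl
  repositionAll {s = s} {u} (v ∷ vs) (v∈ ∷ vs∈) c
    with reposition-consistent c v∈
  ... | c′ , cost with repositionAll {s = value (reposition u v s)} vs vs∈ c′
  ...   | c″ , eq , costs = c″ , eq , (begin
    suc (time (reposition u v s) + time t)                   ≤⟨ +-mono-≤ cost costs ⟩
    repositionCost + (1 + length vs * repositionCost)        ≡⟨ +-suc repositionCost _ ⟩
    1 + (repositionCost + length vs * repositionCost)        ∎)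
    where
    open ≤-Reasoning
    t = forEach vs (reposition u) (value (reposition u v s))

  -- The allowance 2 covers the end of the traversal and the assignment to `d̃`; the released gap of
  -- `u` pays for the iterations. The loop runs over `N s u` while `M u` tells which lists store
  -- `u`, so the two must agree at `u`.
  rebuild-handled : ∀ {M : Neighbourhoods n} {s u} → Consistent M s → N s u ≡ M u →
                    2 * d s u < d̃ s u ⊎ 2 * d̃ s u < d s u →
                    Handled 2 M s (rebuild u s)
  rebuild-handled {n} {M} {s} {u} c Nu≡Mu far =
    finish (forEach (neighbours s u) (reposition u) s)
      (repositionAll (neighbours s u)
        (subst (λ p → All (_∈ p) (neighbours s u)) Nu≡Mu (all-filter (_∈? N s u) (allFin n))) c)
    where
    setReference : Command n
    setReference s = step record s { d̃ = updateAt (d̃ s) u (const (d s u)) }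

    count : length (neighbours s u) ≡ d s u
    count = trans (length-filter-∈? (N s u)) (trans (cong ∣_∣ Nu≡Mu) (sym (degree c u)))

    -- `e` is the new reference degree of `u`, which `updateAt` makes equal to `d s u` only
    -- propositionally.
    paid : ∀ {τ} → τ ≤ 1 + length (neighbours s u) * repositionCost → ∀ {e} → e ≡ d s u →
           τ + 1 + 2 * repositionCost * ∣ d s u - e ∣ ≤ 2 + gap s u
    paid {τ} τ≤ refl = begin
      τ + 1 + 2 * repositionCost * ∣ d s u - d s u ∣    ≡⟨ cong (λ g → τ + 1 + 2 * repositionCost * g) (∣n-n∣≡0 (d s u)) ⟩
      τ + 1 + 2 * repositionCost * 0                    ≡⟨ cong (τ + 1 +_) (*-zeroʳ (2 * repositionCost)) ⟩
      τ + 1 + 0                                         ≡⟨ +-identityʳ _ ⟩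
      τ + 1                                             ≤⟨ +-monoˡ-≤ 1 τ≤ ⟩
      1 + length (neighbours s u) * repositionCost + 1  ≡⟨ cong (λ k → 1 + k * repositionCost + 1) count ⟩
      1 + d s u * repositionCost + 1                    ≡⟨ +-comm _ 1 ⟩
      2 + d s u * repositionCost                        ≤⟨ +-monoʳ-≤ 2 (*-monoˡ-≤ repositionCost (far⇒≤2*∣-∣ (d s u) (d̃ s u) far)) ⟩
      2 + 2 * ∣ d s u - d̃ s u ∣ * repositionCost        ≡⟨ cong (2 +_) (regroup _ repositionCost) ⟩
      2 + gap s u                                       ∎
      where
      open ≤-Reasoning
      regroup : ∀ g a → 2 * g * a ≡ 2 * a * g
      regroup = solve-∀

    finish : (t : Timed (State n)) →
             Consistent M (value t) ×
             value t ≡ record s { B = B (value t) } ×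
             time t ≤ 1 + length (neighbours s u) * repositionCost →
             Handled 2 M s (t >>= setReference)
    -- Matching on `eq` replaces the state after the loop by `s` with a new `B`, so `d`, `d̃` and
    -- `N` become those of `s` by computation.
    finish t (c′ , eq , cost) with value t | B (value t) | eq
    ... | _ | _ | refl = record
      { consistent = record
          { stored      = stored c′
          ; degree      = degree c
          ; reference≤n = updateAt-elim (λ _ e → e ≤ n) u (degree≤n c u) (λ x _ → reference≤n c x)
          }
      ; sameGraph = refl
      ; amortised = sum-mono-at u
          (λ j j≢u → cong (λ e → 2 * repositionCost * ∣ d s j - e ∣) (updateAt-minimal j u (d̃ s) j≢u))
          (paid cost (updateAt-updates u (d̃ s)))
      }

  -- One step for the test, on top of the 2 steps that a rebuild leaves unpaid.
  check-handled : ∀ {M : Neighbourhoods n} {s u} → Consistent M s → N s u ≡ M u →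
                  Handled 3 M s (check u s)
  check-handled {s = s} {u} c Nu≡Mu with (2 * d s u <? d̃ s u) ⊎-dec (2 * d̃ s u <? d s u)
  ... | yes far = let h = rebuild-handled c Nu≡Mu far in record
    { consistent = consistent h ; sameGraph = sameGraph h ; amortised = s≤s (amortised h) }
  ... | no _    = record
    { consistent = c ; sameGraph = refl ; amortised = s≤s (m≤n+m _ 2) }

  -- Handling one endpoint

  -- By the triangle inequality the gap of `u` grows by at most one unit of weight
  -- `2 * repositionCost`. The general `f` covers increments and decrements at once.
  setDegree-amortised : ∀ (s : State n) {u} (f : ℕ → ℕ) → ∣ f (d s u) - d s u ∣ ≤ 1 →
                        Amortised (1 + 2 * repositionCost) s (step record s { d = updateAt (d s) u f })
  setDegree-amortised s {u} f f-close = sum-mono-at {l = 1 + 2 * repositionCost} u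
    (λ j j≢u → cong (λ e → 2 * repositionCost * ∣ e - d̃ s j ∣) (updateAt-minimal j u (d s) j≢u))
    (s≤s (begin
      a * ∣ updateAt (d s) u f u - d̃ s u ∣                   ≡⟨ cong (λ e → a * ∣ e - d̃ s u ∣) (updateAt-updates u (d s)) ⟩
      a * ∣ f (d s u) - d̃ s u ∣                              ≤⟨ *-monoʳ-≤ a (∣-∣-triangle (f (d s u)) (d s u) (d̃ s u)) ⟩
      a * (∣ f (d s u) - d s u ∣ + ∣ d s u - d̃ s u ∣)        ≤⟨ *-monoʳ-≤ a (+-monoˡ-≤ _ f-close) ⟩
      a * (1 + ∣ d s u - d̃ s u ∣)                            ≡⟨ *-suc a _ ⟩
      a + gap s u                                            ∎))
    where
    open ≤-Reasoning
    a = 2 * repositionCost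

  ∣m+1-m∣≤1 : ∀ m → ∣ m + 1 - m ∣ ≤ 1
  ∣m+1-m∣≤1 m = ≤-reflexive (trans (∣-∣-comm (m + 1) m) (∣m-m+n∣≡n m 1))

  ∣m∸1-m∣≤1 : ∀ m → ∣ m ∸ 1 - m ∣ ≤ 1
  ∣m∸1-m∣≤1 zero    = z≤n
  ∣m∸1-m∣≤1 (suc m) =
    ≤-reflexive (trans (cong (∣ m -_∣) (+-comm 1 m)) (∣m-m+n∣≡n m 1))

  endpointCost : ℕ
  endpointCost = bound + 1 + (1 + 2 * repositionCost + 3)

  -- At the start `N` already contains the new edge while `M` lags behind; handling `u` brings `M`
  -- up to date at `u`, because the list of `w` now stores `u`.
  handleInsertion-handled : ∀ {M : Neighbourhoods n} {s u w} → Consistent M s → w ∉ M u →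
                            N s u ≡ M u ∪ ⁅ w ⁆ →
                            Handled endpointCost (updateAt M u (_∪ ⁅ w ⁆)) s (handleInsertion u w s)
  handleInsertion-handled {n} {M} {s} {u} {w} c w∉Mu Nu≡ = record
    { consistent = consistent checked
    ; sameGraph  = sameGraph checked
    ; amortised  = >>=-amortised s (insertInto w u s) (λ s → increment u s >>= check u)
        -- The potential ignores `B`, so only time counts here. The insertion uses `d̃ s u`, which
        -- is why reference degrees must stay at most `n`.
        (+-monoˡ-≤ (potential s) (+-monoˡ-≤ 1 (insert-time (B s w) u∉B (reference≤n c u))))
        (>>=-amortised s₁ (increment u s₁) (check u)
          (setDegree-amortised s₁ (_+ 1) (∣m+1-m∣≤1 (d s u)))
          (amortised checked))
    }
    where
    s₁ s₂ : State n
    s₁ = value (insertInto w u s)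
    s₂ = value (increment u s₁)
    u∉B : ¬ Stored u (view (B s w))
    u∉B = w∉Mu ∘ to (stored c u w)
    inB⇔ : ∀ x v → Stored x (view (B s₂ v)) ⇔ ((v ≡ w × x ≡ u) ⊎ Stored x (view (B s v)))
    inB⇔ x = updateAt-⊎ (Stored x ∘ view) w (insert-stored (B s w) u∉B (reference≤n c u))
    consistent₂ : Consistent (updateAt M u (_∪ ⁅ w ⁆)) s₂
    consistent₂ = record
      { stored      = λ x v → mk⇔
          -- A change in the list of `w` is a change of `M` at `u`: the two coordinates are
          -- exchanged.
          (from (insertEdge-∈ x) ∘ Sum.map swap (to (stored c x v)) ∘ to (inB⇔ x v))
          (from (inB⇔ x v) ∘ Sum.map swap (from (stored c x v)) ∘ to (insertEdge-∈ x))
      ; degree      = updateAt⁺ (λ k p → k ≡ ∣ p ∣) u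
          (trans (cong (_+ 1) (degree c u)) (sym (∣p∪⁅x⁆∣≡∣p∣+1 w∉Mu))) (degree c)
      ; reference≤n = reference≤n c
      }
    checked : Handled 3 (updateAt M u (_∪ ⁅ w ⁆)) s₂ (check u s₂)
    checked = check-handled consistent₂ (trans Nu≡ (sym (updateAt-updates u M)))

  handleDeletion-handled : ∀ {M : Neighbourhoods n} {s u w} → Consistent M s → w ∈ M u →
                           N s u ≡ M u ∖ w →
                           Handled endpointCost (updateAt M u (_∖ w)) s (handleDeletion u w s)
  handleDeletion-handled {n} {M} {s} {u} {w} c w∈Mu Nu≡ = record
    { consistent = consistent checked
    ; sameGraph  = sameGraph checked
    ; amortised  = >>=-amortised s (removeFrom w u s) (λ s → decrement u s >>= check u)
        (+-monoˡ-≤ (potential s) (+-monoˡ-≤ 1 (remove-time (B s w) u∈B)))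
        (>>=-amortised s₁ (decrement u s₁) (check u)
          (setDegree-amortised s₁ (_∸ 1) (∣m∸1-m∣≤1 (d s u)))
          (amortised checked))
    }
    where
    s₁ s₂ : State n
    s₁ = value (removeFrom w u s)
    s₂ = value (decrement u s₁)
    u∈B : Stored u (view (B s w))
    u∈B = from (stored c u w) w∈Mu
    inB⇔ : ∀ x v → Stored x (view (B s₂ v)) ⇔ (¬ (v ≡ w × x ≡ u) × Stored x (view (B s v)))
    inB⇔ x = updateAt-× (Stored x ∘ view) w (remove-stored (B s w) u∈B)
    consistent₂ : Consistent (updateAt M u (_∖ w)) s₂
    consistent₂ = record
      { stored      = λ x v → mk⇔
          (from (deleteEdge-∈ x) ∘ map-× (_∘ swap) (to (stored c x v)) ∘ to (inB⇔ x v))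
          (from (inB⇔ x v) ∘ map-× (_∘ swap) (from (stored c x v)) ∘ to (deleteEdge-∈ x))
      ; degree      = updateAt⁺ (λ k p → k ≡ ∣ p ∣) u
          -- As `w ∈ M u`, the degree is positive and the truncated subtraction is exact.
          (trans (cong (_∸ 1) (trans (degree c u) (sym (∣p∖x∣+1≡∣p∣ w∈Mu)))) (m+n∸n≡m _ 1)) (degree c)
      ; reference≤n = reference≤n c
      }
    checked : Handled 3 (updateAt M u (_∖ w)) s₂ (check u s₂)
    checked = check-handled consistent₂ (trans Nu≡ (sym (updateAt-updates u M)))

  -- Whole updates and update sequences

  record Invariant (G : Graph n) (s : State n) : Set where
    field
      consistent : Consistent (Graph.N G) s
      graph      : N s ≗ Graph.N G

  updateCost : ℕ
  updateCost = 1 + (endpointCost + endpointCost)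

  process-amortised : ∀ {G : Graph n} {s} e (adm : Admissible (Graph.N G) e) → Invariant G s →
                      Invariant (edited G e adm) (value (process e s)) ×
                      Amortised updateCost s (process e s)
  process-amortised {n} {G} {s} e@(insertion u w) (u≢w , w∉Nu) inv =
    record { consistent = consistent handled-w
           ; graph      = λ x →
               trans (cong-app (trans (sameGraph handled-w) (sameGraph handled-u)) x) (graph₁ x) } ,
    s≤s (>>=-amortised s₁ (handleInsertion u w s₁) (handleInsertion w u)
      (amortised handled-u) (amortised handled-w))
    where
    M = Graph.N G
    s₁ s₂ : State n
    s₁ = value (editGraph e s)
    s₂ = value (handleInsertion u w s₁)
    M₁ : Neighbourhoods n
    -- Halfway through the update: the list of `w` stores `u`, but the list of `u` does not yet
    -- store `w`.
    M₁ = updateAt M u (_∪ ⁅ w ⁆)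
    graph₁ : N s₁ ≗ edit e M
    graph₁ = edit-cong e (Invariant.graph inv)
    consistent₁ : Consistent M s₁
    consistent₁ = record { Consistent (Invariant.consistent inv) }
    handled-u : Handled endpointCost M₁ s₁ (handleInsertion u w s₁)
    handled-u = handleInsertion-handled consistent₁ w∉Nu
      (trans (graph₁ u) (trans (updateAt-minimal u w M₁ u≢w) (updateAt-updates u M)))
    u∉M₁w : u ∉ M₁ w
    -- Handling `u` leaves `M` alone at `w`, so the precondition at `w` follows from the symmetry of
    -- the old graph.
    u∉M₁w = subst (u ∉_) (sym (updateAt-minimal w u M (u≢w ∘ sym))) (w∉Nu ∘ Graph.symmetric G)
    handled-w : Handled endpointCost (edit e M) s₂ (handleInsertion w u s₂)
    handled-w = handleInsertion-handled (consistent handled-u) u∉M₁w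
      (trans (cong-app (sameGraph handled-u) w) (trans (graph₁ w) (updateAt-updates w M₁)))
  process-amortised {n} {G} {s} e@(deletion u w) w∈Nu inv =
    record { consistent = consistent handled-w
           ; graph      = λ x →
               trans (cong-app (trans (sameGraph handled-w) (sameGraph handled-u)) x) (graph₁ x) } ,
    s≤s (>>=-amortised s₁ (handleDeletion u w s₁) (handleDeletion w u)
      (amortised handled-u) (amortised handled-w))
    where
    M = Graph.N G
    u≢w : u ≢ w
    -- Admissibility of a deletion does not state distinctness; it comes from the absence of loops.
    u≢w refl = Graph.loopless G w∈Nu
    s₁ s₂ : State n
    s₁ = value (editGraph e s)
    s₂ = value (handleDeletion u w s₁)
    M₁ : Neighbourhoods n
    M₁ = updateAt M u (_∖ w)
    graph₁ : N s₁ ≗ edit e M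
    graph₁ = edit-cong e (Invariant.graph inv)
    -- No field of `Consistent` mentions `N`, so editing the graph preserves all of them.
    consistent₁ : Consistent M s₁
    consistent₁ = record { Consistent (Invariant.consistent inv) }
    handled-u : Handled endpointCost M₁ s₁ (handleDeletion u w s₁)
    handled-u = handleDeletion-handled consistent₁ w∈Nu
      (trans (graph₁ u) (trans (updateAt-minimal u w M₁ u≢w) (updateAt-updates u M)))
    u∈M₁w : u ∈ M₁ w
    u∈M₁w = subst (u ∈_) (sym (updateAt-minimal w u M (u≢w ∘ sym))) (Graph.symmetric G w∈Nu)
    handled-w : Handled endpointCost (edit e M) s₂ (handleDeletion w u s₂)
    handled-w = handleDeletion-handled (consistent handled-u) u∈M₁w
      (trans (cong-app (sameGraph handled-u) w) (trans (graph₁ w) (updateAt-updates w M₁)))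

  -- `edited` is defined by cases, so this equation computes only once the kind of update is known.
  edit-edited : ∀ (G : Graph n) e adm → Graph.N (edited G e adm) ≡ edit e (Graph.N G)
  edit-edited G (insertion u w) adm = refl
  edit-edited G (deletion  u w) adm = refl

  processAll-amortised : ∀ {G : Graph n} {s} es → AllAdmissible (Graph.N G) es → Invariant G s →
                         Amortised (updateCost * length es) s (processAll es s)
  processAll-amortised []       _            inv = m≤n+m _ _
  processAll-amortised {G = G} {s} (e ∷ es) (adm , adms) inv with process-amortised e adm inv
  ... | inv′ , am = subst (λ k → Amortised k s (processAll (e ∷ es) s)) (sym (*-suc updateCost (length es)))
    (>>=-amortised s (process e s) (processAll es) am
      (processAll-amortised es
        (subst (λ M → AllAdmissible M es) (sym (edit-edited G e adm)) adms) inv′))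

  initial-invariant : ∀ {G : Graph n} {s} → Initial G s → Invariant G s
  initial-invariant {n} {G} {s} i = record
    { consistent = record
        { stored      = λ x v → mk⇔
            -- `B-initial` speaks of the owner of the list and `Consistent` of the stored vertex;
            -- symmetry of the graph mediates.
            (λ (j , x∈) → Graph.symmetric G (proj₁ (to (B-initial v x j) x∈)))
            (λ v∈Nx → let j , δ∈j = bucketIndex (d̃ s x) in
                      j , from (B-initial v x j) (Graph.symmetric G v∈Nx , δ∈j))
        ; degree      = d-initial
        ; reference≤n = λ x → subst (_≤ n) (sym (trans (d̃-initial x) (d-initial x))) (∣p∣≤n (Graph.N G x))
        }
    ; graph = N-initial
    }
    where open Initial i

  initial-potential : ∀ {G : Graph n} {s} → Initial G s → potential s ≡ 0
  initial-potential {n} {s = s} i = trans (sum-cong-≗ gap≡0) (sum-replicate-zero n)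
    where
    gap≡0 : ∀ x → gap s x ≡ 0
    gap≡0 x = trans (cong (2 * repositionCost *_) (m≡n⇒∣m-n∣≡0 (sym (Initial.d̃-initial i x))))
                    (*-zeroʳ (2 * repositionCost))

theorem3 : (lists : BucketLists) → let open AGP-Dynamic lists in
    ∃ λ (C : ℕ) →
    ∀ (n : ℕ) (G : Graph n) (s : State n) (es : List (Update n)) →
    Initial G s →
    AllAdmissible (Graph.N G) es →
    time (processAll es s) ≤ C * length es
theorem3 lists = updateCost lists , λ n G s es i adm → begin
  -- The final potential is a natural number and can be added for free; the initial one vanishes.
  -- The constant depends on `bound` alone, hence not on `n`.
  time (processAll es s)                                                  ≤⟨ m≤m+n _ _ ⟩
  time (processAll es s) + potential lists (value (processAll es s))      ≤⟨ processAll-amortised lists es adm (initial-invariant lists i) ⟩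
  updateCost lists * length es + potential lists s                        ≡⟨ cong (updateCost lists * length es +_) (initial-potential lists i) ⟩
  updateCost lists * length es + 0                                        ≡⟨ +-identityʳ _ ⟩
  updateCost lists * length es                                            ∎
  where
  open ≤-Reasoning
  open AGP-Dynamic lists
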